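{- Every word of length $25$ over the binary alphabet $\{a,b\}$ that contains neither $aaa$ nor $bb$ as a factor contains an abelian $5$-power. This bound is tight: the word $aababaababaababaababaaba$ of length $24$ contains neither $aaa$ nor $bb$ as a factor and does not contain an abelian $5$-power.
   Context: A factor of a word is a contiguous subword. A word contains an abelian $k$-power if it has a factor of the form $v_1v_2\cdots v_k$ where $v_1,\dots,v_k$ are non-empty words that are permutations (anagrams) of one another. -}

module Defs where

open import Level using (Level)
open import Data.Nat using (ℕ)
open import Data.List using (List; []; _∷_; concat)
open import Data.List.Relation.Binary.Infix.Heterogeneous using (Infix)
open import Data.List.Relation.Binary.Permutation.Propositional using (_↭_)
open import Data.Product using (Σ-syntax; ∃-syntax; _×_)
open import Data.Vec using (Vec; toList)
open import Data.Vec.Relation.Unary.All using (All)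
open import Data.Vec.Relation.Unary.AllPairs using (AllPairs)
open import Relation.Binary.PropositionalEquality using (_≡_; _≢_)

private
  variable
    ℓ : Level

data Letter : Set where
  a b : Letter

Word : Set
Word = List Letter

infix 4 _IsFactorOf_

_IsFactorOf_ : {A : Set ℓ} → List A → List A → Set ℓ
u IsFactorOf w = Infix _≡_ u w

-- Only v i ↭ v j with i < j is demanded; as _↭_ is an equivalence relation,
-- this makes all the blocks permutations of one another.
IsAbelianPower : {A : Set ℓ} → ℕ → List A → Set ℓ
IsAbelianPower {A = A} k u =
  Σ[ vs ∈ Vec (List A) k ]
    All (_≢ []) vs × AllPairs _↭_ vs × u ≡ concat (toList vs)

ContainsAbelianPower : {A : Set ℓ} → ℕ → List A → Set ℓ
ContainsAbelianPower k w = ∃[ u ] u IsFactorOf w × IsAbelianPower k u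

aaa bb : Word
aaa = a ∷ a ∷ a ∷ []
bb  = b ∷ b ∷ []

-- aababaababaababaababaaba
extremalWord : Word
extremalWord =
  a ∷ a ∷ b ∷ a ∷ b ∷ a ∷ a ∷ b ∷ a ∷ b ∷ a ∷ a ∷
  b ∷ a ∷ b ∷ a ∷ a ∷ b ∷ a ∷ b ∷ a ∷ a ∷ b ∷ a ∷ []

{-# OPTIONS --safe #-}

-- Avoiding aaa, bb and abelian 5-powers is inherited by prefixes, so the words
-- that do so form a tree under right extension.  That tree is small (424 nodes,
-- the empty word included) and an exhaustive search finds its height, 24.  The
-- test for an abelian power at the start of a word tries each length for the
-- first block v and compares v with the following segments of the same length.

module Submission where

open import Defs
open import Data.Empty using (⊥-elim)
open import Data.List
  using (List; []; _∷_; _++_; _∷ʳ_; concat; drop; length; take)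
open import Data.List.Membership.Propositional.Properties using (∈-∃++)
import Data.List.Membership.DecPropositional as DecMembership
open import Data.List.Properties
  using (++-assoc; ++-identityʳ; length-++; take++drop≡id; ∷ʳ-++)
open import Data.List.Relation.Binary.Infix.Heterogeneous
  using (here; there; _ⁱ++_)
open import Data.List.Relation.Binary.Infix.Heterogeneous.Properties
  using (infix?)
open import Data.List.Relation.Binary.Permutation.Propositional
  using (_↭_; prep; ↭-refl; ↭-sym; ↭-trans)
open import Data.List.Relation.Binary.Permutation.Propositional.Properties
  using (¬x∷xs↭[]; drop-mid; shift; ∈-resp-↭; ↭-length)
open import Data.List.Relation.Binary.Pointwise using (Pointwise-≡⇒≡; ≡⇒Pointwise-≡)
open import Data.List.Relation.Binary.Prefix.Heterogeneous
  using (Prefix; []; fromView; toView) renaming (_++_ to _++ᵛ_)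
open import Data.List.Relation.Unary.Any using (here)
open import Data.Nat using (ℕ; zero; suc; _≤_; _<_; s≤s)
open import Data.Nat.Properties using (anyUpTo?; m≤m+n; suc-injective)
open import Data.Product using (_×_; _,_; ∃-syntax)
open import Data.Sum using (_⊎_; inj₁; inj₂; [_,_]′) renaming (map to ⊎-map)
open import Data.Unit.Polymorphic using (⊤)
open import Data.Vec using (Vec; []; _∷_; toList)
open import Data.Vec.Relation.Unary.All as All using (All; []; _∷_)
open import Data.Vec.Relation.Unary.AllPairs using (AllPairs; []; _∷_)
open import Function using (id; _∘_)
open import Level using (Level)
open import Relation.Binary using (DecidableEquality)
open import Relation.Binary.PropositionalEquality
  using (_≡_; refl; sym; trans; cong; subst)
open import Relation.Nullary using (Dec; yes; no; ¬_; contradiction)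
open import Relation.Nullary.Decidable
  using (from-no; from-yes; map′; _×-dec_; _⊎-dec_)

private
  variable
    ℓ : Level
    A : Set ℓ
    k : ℕ

prefix-++ : (u s : List A) → Prefix _≡_ u (u ++ s)
prefix-++ u s = fromView (≡⇒Pointwise-≡ refl ++ᵛ s)

prefix⇒++ : {u w : List A} → Prefix _≡_ u w → ∃[ s ] w ≡ u ++ s
prefix⇒++ p with toView p
... | u≋u′ ++ᵛ s = s , cong (_++ s) (sym (Pointwise-≡⇒≡ u≋u′))

take-++-length : (u s : List A) → take (length u) (u ++ s) ≡ u
take-++-length []      s = refl
take-++-length (x ∷ u) s = cong (x ∷_) (take-++-length u s)

drop-++-length : (u s : List A) → drop (length u) (u ++ s) ≡ s
drop-++-length []      s = refl
drop-++-length (x ∷ u) s = drop-++-length u s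

-- w begins with k further blocks of an abelian power whose first block is v;
-- truncation by take is harmless, as _↭_ forces equal lengths.
Run : {A : Set ℓ} → List A → ℕ → List A → Set ℓ
Run v zero    w = ⊤
Run v (suc k) w = v ↭ take (length v) w × Run v k (drop (length v) w)

run⇒blocks : (v : List A) (k : ℕ) (w : List A) → Run v k w →
  ∃[ vs ] All (v ↭_) {k} vs × ∃[ s ] w ≡ concat (toList vs) ++ s
run⇒blocks v zero    w _ = [] , [] , w , refl
run⇒blocks v (suc k) w (v↭x , run)
  with run⇒blocks v k (drop (length v) w) run
... | vs , v↭vs , s , eq = x ∷ vs , v↭x ∷ v↭vs , s ,
  trans (sym (take++drop≡id (length v) w))
        (trans (cong (x ++_) eq) (sym (++-assoc x (concat (toList vs)) s)))
  where x = take (length v) w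

blocks⇒run : {v : List A} {vs : Vec (List A) k} → All (v ↭_) vs →
  (s : List A) → Run v k (concat (toList vs) ++ s)
blocks⇒run [] s = _
blocks⇒run {v = v} {vs = x ∷ vs} (v↭x ∷ v↭vs) s
  rewrite ++-assoc x (concat (toList vs)) s
        -- `Run` cuts at `length v`, while the block present is `x`; equal lengths let the cut fall
        -- exactly at the end of `x`.
        | ↭-length v↭x
        = subst (v ↭_) (sym (take-++-length x _)) v↭x
        , subst (Run v _) (sym (drop-++-length x _)) (blocks⇒run v↭vs s)

pairwise-↭ : {v : List A} {vs : Vec (List A) k} → All (v ↭_) vs → AllPairs _↭_ vs
pairwise-↭ []           = []
pairwise-↭ (v↭x ∷ v↭vs) =
  All.map (↭-trans (↭-sym v↭x)) v↭vs ∷ pairwise-↭ v↭vs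

StartsWithAbelianPower : {A : Set ℓ} → ℕ → List A → Set ℓ
StartsWithAbelianPower k w = ∃[ u ] Prefix _≡_ u w × IsAbelianPower k u

run⇒power : (c : A) (m : ℕ) (w : List A) → Run (c ∷ take m w) k (drop m w) →
  StartsWithAbelianPower (suc k) (c ∷ w)
run⇒power c m w run with run⇒blocks (c ∷ take m w) _ (drop m w) run
... | vs , v↭vs , s , eq =
  _ , subst (Prefix _≡_ (v ++ concat (toList vs))) (sym split) (prefix-++ _ s) ,
  v ∷ vs ,
  -- The later blocks are non-empty because a permutation of a non-empty list is non-empty.
  (λ ()) ∷ All.map (λ { v↭x refl → ¬x∷xs↭[] v↭x }) v↭vs ,
  v↭vs ∷ pairwise-↭ v↭vs ,
  refl
  where
  v = c ∷ take m w
  split : c ∷ w ≡ (v ++ concat (toList vs)) ++ s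
  split = trans (cong (c ∷_) (sym (take++drop≡id m w)))
         (trans (cong (v ++_) eq) (sym (++-assoc v (concat (toList vs)) s)))

-- The witness `m` is the length of the first block minus one. That block fits inside `c ∷ w`, which
-- bounds `m` and makes the search for it finite.
power⇒run : (c : A) (w : List A) → StartsWithAbelianPower (suc k) (c ∷ w) →
  ∃[ m ] m < suc (length w) × Run (c ∷ take m w) k (drop m w)
power⇒run c w (_ , p , [] ∷ _ , v≢[] ∷ _ , _) = contradiction refl v≢[]
power⇒run c w (_ , p , (x ∷ v) ∷ vs , _ , v↭vs ∷ _ , refl)
  with s , refl ← prefix⇒++ p
  rewrite ++-assoc v (concat (toList vs)) s
  = length v ,
    s≤s (subst (length v ≤_) (sym (length-++ v)) (m≤m+n _ _)) ,
    run
  where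
  run : Run (x ∷ take (length v) (v ++ concat (toList vs) ++ s)) _
            (drop (length v) (v ++ concat (toList vs) ++ s))
  run rewrite take-++-length v (concat (toList vs) ++ s)
            | drop-++-length v (concat (toList vs) ++ s)
            = blocks⇒run v↭vs s

power≢[] : ¬ StartsWithAbelianPower {A = A} (suc k) []
power≢[] (_ , [] , [] ∷ _ , v≢[] ∷ _ , _) = v≢[] refl

module _ {A : Set ℓ} (_≟_ : DecidableEquality A) where

  open DecMembership _≟_ using (_∈?_)

  infix 4 _↭?_

  -- Cancels the head of `xs` against an occurrence in `ys`. The choice of occurrence is immaterial:
  -- by `drop-mid` and `shift`, the remainders are permutations of each other exactly when the full
  -- lists are.
  _↭?_ : (xs ys : List A) → Dec (xs ↭ ys)
  []       ↭? []       = yes ↭-refl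
  []       ↭? (y ∷ ys) = no (¬x∷xs↭[] ∘ ↭-sym)
  (x ∷ xs) ↭? ys with x ∈? ys
  ... | no x∉ys = no λ p → x∉ys (∈-resp-↭ p (here refl))
  ... | yes x∈ys with as , bs , refl ← ∈-∃++ x∈ys =
    map′ (λ p → ↭-trans (prep x p) (↭-sym (shift x as bs)))
         (drop-mid [] as)
         (xs ↭? as ++ bs)

  run? : (v : List A) (k : ℕ) (w : List A) → Dec (Run v k w)
  run? v zero    w = yes _
  run? v (suc k) w =
    (v ↭? take (length v) w) ×-dec run? v k (drop (length v) w)

  -- The index `suc k` guarantees a first block, hence a non-empty power; the empty word is an
  -- abelian 0-power.
  startsWithAbelianPower? : (k : ℕ) (w : List A) →
    Dec (StartsWithAbelianPower (suc k) w)
  startsWithAbelianPower? k []      = no power≢[]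
  startsWithAbelianPower? k (c ∷ w) =
    map′ (λ (m , _ , run) → run⇒power c m w run) (power⇒run c w)
         (anyUpTo? (λ m → run? (c ∷ take m w) k (drop m w)) (suc (length w)))

  containsAbelianPower? : (k : ℕ) (w : List A) →
    Dec (ContainsAbelianPower (suc k) w)
  containsAbelianPower? k [] =
    no λ { (u , here p , pow) → power≢[] (u , p , pow) }
  containsAbelianPower? k (c ∷ w) =
    map′ [ (λ (u , p , pow) → u , here p , pow)
         , (λ (u , i , pow) → u , there i , pow) ]′
         (λ { (u , here p , pow)  → inj₁ (u , p , pow)
            ; (u , there i , pow) → inj₂ (u , i , pow) })
         (startsWithAbelianPower? k (c ∷ w) ⊎-dec containsAbelianPower? k w)

_≟_ : DecidableEquality Letter
a ≟ a = yes refl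
a ≟ b = no λ ()
b ≟ a = no λ ()
b ≟ b = yes refl

Forced : (Word → Set) → ℕ → Word → Set
Forced P n p = (w : Word) → length w ≡ n → P (p ++ w)

module _ {P : Word → Set} (P? : (w : Word) → Dec (P w))
         (extend : (u v : Word) → P u → P (u ++ v)) where

  -- Since `P` survives right extension, a branch closes as soon as `P p` holds. The disjunction is
  -- evaluated lazily, so the search visits only words failing `P` and their one-letter extensions.
  forced? : (n : ℕ) (p : Word) → Dec (Forced P n p)
  forced? zero p =
    map′ (λ { Pp [] refl → extend p [] Pp })
         (λ f → subst P (++-identityʳ p) (f [] refl))
         (P? p)
  forced? (suc n) p =
    map′ [ (λ Pp w _ → extend p w Pp) , join ]′
         -- Forcedness passes to both children whether or not `P p` holds, so the second alternative
         -- is always available.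
         (λ f → inj₂ (split f a , split f b))
         (P? p ⊎-dec (forced? n (p ∷ʳ a) ×-dec forced? n (p ∷ʳ b)))
    where
    join : Forced P n (p ∷ʳ a) × Forced P n (p ∷ʳ b) → Forced P (suc n) p
    join (f , g) (a ∷ w) eq = subst P (∷ʳ-++ p a w) (f w (suc-injective eq))
    join (f , g) (b ∷ w) eq = subst P (∷ʳ-++ p b w) (g w (suc-injective eq))

    split : Forced P (suc n) p → (c : Letter) → Forced P n (p ∷ʳ c)
    split f c w eq = subst P (sym (∷ʳ-++ p c w)) (f (c ∷ w) (cong suc eq))

factor? : (u w : Word) → Dec (u IsFactorOf w)
factor? = infix? _≟_

Unavoiding : Word → Set
Unavoiding w = aaa IsFactorOf w ⊎ bb IsFactorOf w ⊎ ContainsAbelianPower 5 w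

unavoiding? : (w : Word) → Dec (Unavoiding w)
unavoiding? w =
  -- The cheap factor tests come first. The argument `4` counts the blocks after the first, so it
  -- stands for 5-powers.
  factor? aaa w ⊎-dec factor? bb w ⊎-dec containsAbelianPower? _≟_ 4 w

unavoiding-++ : (u v : Word) → Unavoiding u → Unavoiding (u ++ v)
unavoiding-++ u v =
  ⊎-map (_ⁱ++ v) (⊎-map (_ⁱ++ v) λ (x , i , pow) → x , i ⁱ++ v , pow)

-- Proved by computation: the type of `from-yes` reduces to the claim only once the search from the
-- empty word has evaluated to `yes`.
length25-unavoiding : Forced Unavoiding 25 []
length25-unavoiding = from-yes (forced? unavoiding? unavoiding-++ 25 [])

proposition4p2 : ((w : Word) → length w ≡ 25 →
    ¬ (aaa IsFactorOf w) → ¬ (bb IsFactorOf w) →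
    ContainsAbelianPower 5 w)
    × (length extremalWord ≡ 24
    × ¬ (aaa IsFactorOf extremalWord)
    × ¬ (bb IsFactorOf extremalWord)
    × ¬ ContainsAbelianPower 5 extremalWord)
proposition4p2 =
  (λ w eq ¬aaa ¬bb →
    [ ⊥-elim ∘ ¬aaa , [ ⊥-elim ∘ ¬bb , id ]′ ]′ (length25-unavoiding w eq)) ,
  refl ,
  -- Tightness is settled by running the same decision procedures on the single word `extremalWord`.
  from-no (factor? aaa extremalWord) ,
  from-no (factor? bb extremalWord) ,
  from-no (containsAbelianPower? _≟_ 4 extremalWord)
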